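{- In the deductive system $NOM$, for all finite sequences of formulas $\Gamma$ and all formulas $\phi,\psi$, the following two rules of inference are derivable: from $\Gamma \vdash \phi \rightarrow \psi$ infer $\Gamma \vdash \neg(\phi \wedge \neg(\phi \wedge \psi))$; and from $\Gamma \vdash \neg(\phi \wedge \neg(\phi \wedge \psi))$ infer $\Gamma \vdash \phi \rightarrow \psi$.
   Context: The propositional deductive system $NOM$: formulas are built from propositional letters using the binary connectives $\wedge$, $\rightarrow$ and the unary connective $\neg$. A sequent is an expression $\phi_1,\ldots,\phi_n \vdash \psi$ with $n\ge 0$, whose antecedent is a finite sequence (order matters, repetitions allowed) of formulas. Below $\Gamma$ denotes a finite, possibly empty, sequence of formulas, $\phi,\psi,\chi$ formulas, and commas denote concatenation. A sequent is derivable in $NOM$ if it can be obtained with the following rules (premises $\Rightarrow$ conclusion): (assumption) $\Gamma,\phi\vdash\phi$, no premises; (cut) $\Gamma\vdash\phi$ and $\Gamma,\phi\vdash\psi$ $\Rightarrow$ $\Gamma\vdash\psi$; (paste) $\Gamma\vdash\phi$ and $\Gamma\vdash\psi$ $\Rightarrow$ $\Gamma,\phi\vdash\psi$; (compatible exchange) $\Gamma,\phi,\psi\vdash\phi$ and $\Gamma,\phi,\psi\vdash\chi$ and $\Gamma,\psi,\phi\vdash\psi$ $\Rightarrow$ $\Gamma,\psi,\phi\vdash\chi$; ($\wedge$-introduction) $\Gamma\vdash\phi$ and $\Gamma\vdash\psi$ $\Rightarrow$ $\Gamma\vdash\phi\wedge\psi$; ($\wedge$-elimination) $\Gamma\vdash\phi\wedge\psi$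 $\Rightarrow$ $\Gamma\vdash\phi$, and $\Gamma\vdash\phi\wedge\psi$ $\Rightarrow$ $\Gamma\vdash\psi$; ($\rightarrow$-introduction) $\Gamma,\phi\vdash\psi$ $\Rightarrow$ $\Gamma\vdash\phi\rightarrow\psi$; ($\rightarrow$-elimination) $\Gamma\vdash\phi\rightarrow\psi$ $\Rightarrow$ $\Gamma,\phi\vdash\psi$; (excluded middle) $\Gamma,\phi\vdash\psi$ and $\Gamma,\neg\phi\vdash\psi$ $\Rightarrow$ $\Gamma\vdash\psi$; (deductive explosion) $\Gamma\vdash\neg\phi$ $\Rightarrow$ $\Gamma,\phi\vdash\psi$. A rule schema is derivable if in every instance its conclusion can be derived from its premises using these rules. -}

module Defs where

open import Data.List.Base using (List; []; _∷_)
open import Data.List.Membership.Propositional using (_∈_)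
open import Level using (Level)

private
  variable
    a : Level

infix  9 ¬_
infixr 7 _∧_
infixr 6 _⇒_
infixl 5 _▷_
infix  4 _⊢_
infix  3 _⊩_

data Formula (Atom : Set a) : Set a where
  letter : Atom → Formula Atom
  _∧_    : Formula Atom → Formula Atom → Formula Atom
  _⇒_    : Formula Atom → Formula Atom → Formula Atom
  ¬_     : Formula Atom → Formula Atom

-- Antecedents are lists stored with the rightmost formula at the head, since
-- every rule acts on the right end: Γ ▷ φ is the sequence written "Γ, φ".
Antecedent : Set a → Set a
Antecedent Atom = List (Formula Atom)

pattern _▷_ Γ φ = φ ∷ Γ

data Sequent (Atom : Set a) : Set a where
  _⊢_ : Antecedent Atom → Formula Atom → Sequent Atom

-- H ⊩ S: the sequent S has a NOM derivation whose leaves may, besides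
-- assumption axioms, be sequents in H.  Thus [] ⊩ S is derivability in NOM, and
-- the rule with premises H and conclusion S is derivable when H ⊩ S.  This is
-- derivability and not mere admissibility: H need not be derivable in NOM.
data _⊩_ {Atom : Set a} (H : List (Sequent Atom)) : Sequent Atom → Set a where

  premise : ∀ {S} → S ∈ H → H ⊩ S

  assumption : ∀ {Γ φ} → H ⊩ Γ ▷ φ ⊢ φ

  cut : ∀ {Γ φ ψ} →
        H ⊩ Γ ⊢ φ →
        H ⊩ Γ ▷ φ ⊢ ψ →
        H ⊩ Γ ⊢ ψ

  paste : ∀ {Γ φ ψ} →
          H ⊩ Γ ⊢ φ →
          H ⊩ Γ ⊢ ψ →
          H ⊩ Γ ▷ φ ⊢ ψ

  compatible-exchange : ∀ {Γ φ ψ χ} →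
                        H ⊩ Γ ▷ φ ▷ ψ ⊢ φ →
                        H ⊩ Γ ▷ φ ▷ ψ ⊢ χ →
                        H ⊩ Γ ▷ ψ ▷ φ ⊢ ψ →
                        H ⊩ Γ ▷ ψ ▷ φ ⊢ χ

  ∧-intro : ∀ {Γ φ ψ} →
            H ⊩ Γ ⊢ φ →
            H ⊩ Γ ⊢ ψ →
            H ⊩ Γ ⊢ φ ∧ ψ

  ∧-elimˡ : ∀ {Γ φ ψ} →
            H ⊩ Γ ⊢ φ ∧ ψ →
            H ⊩ Γ ⊢ φ

  ∧-elimʳ : ∀ {Γ φ ψ} →
            H ⊩ Γ ⊢ φ ∧ ψ →
            H ⊩ Γ ⊢ ψ

  ⇒-intro : ∀ {Γ φ ψ} →
            H ⊩ Γ ▷ φ ⊢ ψ →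
            H ⊩ Γ ⊢ φ ⇒ ψ

  ⇒-elim : ∀ {Γ φ ψ} →
           H ⊩ Γ ⊢ φ ⇒ ψ →
           H ⊩ Γ ▷ φ ⊢ ψ

  excluded-middle : ∀ {Γ φ ψ} →
                    H ⊩ Γ ▷ φ ⊢ ψ →
                    H ⊩ Γ ▷ ¬ φ ⊢ ψ →
                    H ⊩ Γ ⊢ ψ

  explosion : ∀ {Γ φ ψ} →
              H ⊩ Γ ⊢ ¬ φ →
              H ⊩ Γ ▷ φ ⊢ ψ

{-# OPTIONS --safe #-}
-- Write α = φ ∧ ψ and θ = φ ∧ ¬ α.  The rules have no weakening: ¬ β may be
-- lost when α is appended to the antecedent.  It survives as soon as
-- Γ, α, β ⊢ α, because compatible exchange then reduces Γ, α, β to the explosive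
-- Γ, β, α (¬-persists); dually, ¬ β can be inferred from Γ, α ⊢ ¬ β as soon as
-- Γ, β ⊢ α (¬-through).  Every exchange needed is of one of these kinds, because
-- θ entails both φ and ¬ α, and ¬ φ entails ¬ α.
module Submission where

open import Data.List.Base using (List; []; _∷_)
open import Data.List.Relation.Unary.Any using (here)
open import Data.Product.Base using (_×_; _,_)
open import Relation.Binary.PropositionalEquality using (refl)
open import Defs

module _ {a} {Atom : Set a} {H : List (Sequent Atom)} where

  private
    variable
      Γ : Antecedent Atom
      α β φ ψ χ : Formula Atom

  contradiction : H ⊩ Γ ⊢ φ → H ⊩ Γ ⊢ ¬ φ → H ⊩ Γ ⊢ χ
  contradiction p ¬p = cut p (explosion ¬p)

  ¬-intro : H ⊩ Γ ▷ φ ⊢ ¬ φ → H ⊩ Γ ⊢ ¬ φ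
  ¬-intro p = excluded-middle p assumption

  ¬¬-elim : H ⊩ Γ ⊢ ¬ ¬ φ → H ⊩ Γ ⊢ φ
  ¬¬-elim p = excluded-middle assumption (explosion p)

  -- Splitting on ¬ φ to prove ¬ ¬ φ directly is circular (Γ, ¬ φ need not keep
  -- φ); proving φ ⇒ ¬ ¬ φ instead puts φ back after ¬ φ.
  ¬¬-intro : H ⊩ Γ ⊢ φ → H ⊩ Γ ⊢ ¬ ¬ φ
  ¬¬-intro p = cut p (⇒-elim (excluded-middle
    (⇒-intro (explosion assumption))
    (⇒-intro (paste (¬¬-elim assumption) assumption))))

  ¬-through : H ⊩ Γ ▷ β ⊢ α → H ⊩ Γ ▷ α ⊢ ¬ β → H ⊩ Γ ⊢ ¬ β
  ¬-through β⊢α α⊢¬β = ¬-intro (cut β⊢α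
    -- `Γ ▷ α ▷ β` is explosive, so the exchange yields any conclusion in `Γ ▷ β ▷ α`.
    (compatible-exchange (explosion α⊢¬β) (explosion α⊢¬β) (paste β⊢α assumption)))

  ¬-persists : H ⊩ Γ ⊢ ¬ β → H ⊩ Γ ▷ α ▷ β ⊢ α → H ⊩ Γ ▷ α ⊢ ¬ β
  ¬-persists ¬β αβ⊢α =
    ¬-intro (compatible-exchange explosive explosive αβ⊢α)
    where
    explosive : ∀ {χ} → H ⊩ _ ⊢ χ
    -- `Γ ▷ β` already proves `¬ α`.
    explosive = explosion (explosion ¬β)

  ⇒-to-¬∧¬∧ : H ⊩ Γ ⊢ φ ⇒ ψ → H ⊩ Γ ⊢ ¬ (φ ∧ ¬ (φ ∧ ψ))
  ⇒-to-¬∧¬∧ p = ¬-through (∧-elimˡ assumption)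
    (¬-through (∧-elimʳ assumption)
      -- θ is now split into its conjuncts, and by `p` the first refutes the second.
      (explosion (¬¬-intro (∧-intro assumption (⇒-elim p)))))

  -- Only negations are known to persist, so `φ` is carried along as `¬ ¬ φ`.
  conjunct-persists : H ⊩ Γ ⊢ φ → H ⊩ Γ ▷ ¬ (φ ∧ ψ) ⊢ φ
  conjunct-persists p = ¬¬-elim (¬-persists (¬¬-intro p)
    (¬-through (∧-elimˡ assumption) (explosion assumption)))

  ¬∧¬∧-to-⇒ : H ⊩ Γ ⊢ ¬ (φ ∧ ¬ (φ ∧ ψ)) → H ⊩ Γ ⊢ φ ⇒ ψ
  ¬∧¬∧-to-⇒ p = ⇒-intro (∧-elimʳ (excluded-middle assumption
    (contradiction
      (∧-intro (conjunct-persists assumption) assumption)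
      -- `¬ θ` is carried past `φ`, then past `¬ (φ ∧ ψ)`, both conjuncts of θ.
      (¬-persists (¬-persists p (∧-elimˡ assumption)) (∧-elimʳ assumption)))))

theorem2p10 : ∀ {a} {Atom : Set a} (Γ : Antecedent Atom) (φ ψ : Formula Atom) →
    (((Γ ⊢ φ ⇒ ψ) ∷ []) ⊩ (Γ ⊢ ¬ (φ ∧ ¬ (φ ∧ ψ))))
    × (((Γ ⊢ ¬ (φ ∧ ¬ (φ ∧ ψ))) ∷ []) ⊩ (Γ ⊢ φ ⇒ ψ))
theorem2p10 Γ φ ψ = ⇒-to-¬∧¬∧ (premise (here refl)) , ¬∧¬∧-to-⇒ (premise (here refl))
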